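{- Let $k\ge 1$ be a fixed integer. For integers $n\ge 2^k$, let $\mathcal{L}_n$ be the set of integers between $1$ and $n$ that are not divisible by $2^k$. Then $$f_{\mathcal{L}_n}(n)=(2+o(1))\binom{n}{2^{k-1}-1}\quad\text{as } n\to\infty.$$
   Context: For a set $\mathcal{L}$ of positive integers, $f_{\mathcal{L}}(n)$ denotes the maximum number of vectors in $\{0,1\}^n$ such that the Hamming distance between any two distinct ones lies in $\mathcal{L}$. The Hamming distance between two vectors is the number of coordinates in which they differ. -}

module Defs where

open import Data.Nat using (ℕ; zero; suc; _+_; _*_; _∸_; _^_; _≤_; _<_)
open import Data.Nat.Divisibility using (_∣_)
open import Data.Nat.Combinatorics using (_C_)
open import Data.Bool using (Bool; true; false; if_then_else_)
open import Data.Bool.Properties using () renaming (_≟_ to _≟ᵇ_)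
open import Data.Vec using (Vec; []; _∷_)
open import Data.List using (List; length)
open import Data.List.Membership.Propositional using (_∈_)
open import Data.List.Relation.Unary.Unique.Propositional using (Unique)
open import Data.Product using (_×_; Σ)
open import Relation.Nullary using (¬_; does)
open import Relation.Binary.PropositionalEquality using (_≢_)

hamming : ∀ {n} → Vec Bool n → Vec Bool n → ℕ
hamming []       []       = 0
hamming (x ∷ xs) (y ∷ ys) = (if does (x ≟ᵇ y) then 0 else 1) + hamming xs ys

record Code (L : ℕ → Set) (n : ℕ) : Set where
  field
    words    : List (Vec Bool n)
    distinct : Unique words
    dists    : ∀ {x y} → x ∈ words → y ∈ words → x ≢ y → L (hamming x y)
open Code public

Lset : ℕ → ℕ → ℕ → Set
Lset k n d = (1 ≤ d) × (d ≤ n) × ¬ (2 ^ k ∣ d)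

binom : ℕ → ℕ → ℕ
binom k n = n C (2 ^ (k ∸ 1) ∸ 1)

module Submission where

-- Put t = 2^(k-1) - 1.
--
-- Upper bound. Split a code into its even-weight and odd-weight words; inside
-- a class all distances are even. The polynomial Q(d) = (d-2)(d-4)...(d-2t)
-- satisfies Q(0) = ± 2^t t! and Q(2j) = 2^t t! C(j-1,t), where C(j-1,t) is even
-- unless 2^(k-1) divides j. So the matrix Q(d(x,y)) over a class, divided by
-- 2^t t!, is odd on the diagonal and even off it, hence nonsingular. For fixed x,
-- Q(d(x,y)) is a polynomial of degree at most t in the coordinates of y, so the
-- class has at most C(n,0) + ... + C(n,t) = (1+o(1)) C(n,t) words.
-- Nonsingularity is proved by descent: an integer kernel vector has only even
-- entries, and half of it is again a kernel vector.
--
-- Lower bound. Take all words of weight t on n-1 coordinates, each preceded by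
-- 0 and by 1: distances are at most 2t < 2^k within a layer and odd across layers.

open import Defs
open import Data.Bool using (Bool; true; false)
open import Data.Fin using (Fin; zero; suc; punchIn)
open import Data.Fin.Properties using (any?; punchInᵢ≢i)
open import Data.Integer as ℤ using (ℤ; +_; 0ℤ; 1ℤ)
open import Data.Integer.Divisibility.Signed as ℤ∣ using (divides)
import Data.Integer.Properties as ℤ
import Data.Integer.Tactic.RingSolver as ℤSolver
open import Data.List using (List; []; _∷_; length; map; _++_; filter; lookup)
open import Data.List.Membership.Propositional using (_∈_)
open import Data.List.Membership.Propositional.Properties using (∈-lookup; ∈-filter⁻; ∈-map⁻; ∈-++⁻)
import Data.List.Properties as List
open import Data.List.Relation.Unary.All as All using (All; []; _∷_)
import Data.List.Relation.Unary.All.Properties as All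
open import Data.List.Relation.Unary.AllPairs using ([]; _∷_)
open import Data.List.Relation.Unary.Any using (here)
open import Data.List.Relation.Unary.Unique.Propositional using (Unique)
import Data.List.Relation.Unary.Unique.Propositional.Properties as Unique
open import Data.Nat using (ℕ; zero; suc; _+_; _*_; _∸_; _^_; _≤_; _<_; _⊔_; z≤n; s≤s; NonZero; >-nonZero)
open import Data.Nat.Combinatorics using (_C_; nC1≡n; nCk+nC[k+1]≡[n+1]C[k+1])
open import Data.Nat.Divisibility
  using (_∣_; divides; _∣?_; ∣m+n∣m⇒∣n; ∣m∣n⇒∣m+n; m∣m*n; 1∣_; *-monoʳ-∣; *-cancelˡ-∣; >⇒∤; ∣-trans; ∣-refl)
open import Data.Nat.Primality using (euclidsLemma; prime[2])
import Data.Nat.Properties as ℕ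
import Data.Nat.Tactic.RingSolver as ℕSolver
open import Data.Product using (_×_; Σ; _,_; ∃-syntax; proj₁; proj₂)
open import Data.Sum using (_⊎_; inj₁; inj₂; [_,_]′)
open import Data.Unit using (⊤; tt)
open import Data.Vec using (Vec; []; _∷_; head; tail; replicate)
open import Data.Vec.Functional using (insertAt)
open import Data.Vec.Functional.Properties using (insertAt-lookup; insertAt-punchIn)
open import Algebra.Properties.Semiring.Sum ℤ.+-*-semiring
  using (sum; sum-cong-≗; sum-remove; ∑-distrib-+; *-distribˡ-sum)
open import Function using (_∘_)
open import Level using (0ℓ)
open import Relation.Binary.PropositionalEquality
  using (_≡_; _≢_; _≗_; refl; sym; trans; cong; cong₂; subst; subst₂; module ≡-Reasoning)
open import Relation.Nullary using (¬_; Dec; yes; no; ¬?; contradiction)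
open import Relation.Nullary.Decidable using (decidable-stable)
open import Relation.Unary using (Pred; Decidable)

open ≡-Reasoning

-- Integer linear algebra

infix 7 _·_

_·_ : ∀ {n} → (Fin n → ℤ) → (Fin n → ℤ) → ℤ
f · v = sum (λ i → f i ℤ.* v i)

sum-zero : ∀ {n} {f : Fin n → ℤ} → (∀ i → f i ≡ 0ℤ) → sum f ≡ 0ℤ
sum-zero {zero}  f≡0 = refl
sum-zero {suc n} f≡0 = cong₂ ℤ._+_ (f≡0 zero) (sum-zero (f≡0 ∘ suc))

·-congʳ : ∀ {n} (f : Fin n → ℤ) {v w : Fin n → ℤ} → v ≗ w → f · v ≡ f · w
·-congʳ f v≗w = sum-cong-≗ (λ i → cong (f i ℤ.*_) (v≗w i))

·-scaleʳ : ∀ {n} c (f v : Fin n → ℤ) → f · (λ i → c ℤ.* v i) ≡ c ℤ.* (f · v)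
·-scaleʳ c f v = begin
  sum (λ i → f i ℤ.* (c ℤ.* v i)) ≡⟨ sum-cong-≗ (λ i → swap (f i) c (v i)) ⟩
  sum (λ i → c ℤ.* (f i ℤ.* v i)) ≡⟨ *-distribˡ-sum c (λ i → f i ℤ.* v i) ⟨
  c ℤ.* (f · v)                   ∎
  where
  swap : ∀ x y z → x ℤ.* (y ℤ.* z) ≡ y ℤ.* (x ℤ.* z)
  swap = ℤSolver.solve-∀

-- Fraction-free elimination: cross-multiplying with the pivot `r j` cancels column `j`, which is
-- then dropped, and all entries stay integral.
eliminate : ∀ {n} → Fin (suc n) → (Fin (suc n) → ℤ) → (Fin (suc n) → ℤ) → Fin n → ℤ
eliminate j r s c = r j ℤ.* s (punchIn j c) ℤ.- s j ℤ.* r (punchIn j c)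

-- Solving row `r` for coordinate `j` would divide by `r j`; scaling all other coordinates by `r j`
-- avoids this.
backSubstitute : ∀ {n} → Fin (suc n) → (Fin (suc n) → ℤ) → (Fin n → ℤ) → Fin (suc n) → ℤ
backSubstitute j r w = insertAt (λ c → r j ℤ.* w c) j (ℤ.- ((r ∘ punchIn j) · w))

-- Used twice: with `s` another row it lifts a solution of the eliminated system, and with `s = r`
-- the eliminated row is zero, which gives the pivot equation.
·-backSubstitute : ∀ {n} j (r s : Fin (suc n) → ℤ) (w : Fin n → ℤ) →
                   s · backSubstitute j r w ≡ eliminate j r s · w
·-backSubstitute j r s w = begin
  s · v
    ≡⟨ sum-remove {i = j} (λ c → s c ℤ.* v c) ⟩
  s j ℤ.* v j ℤ.+ sum (λ c → s (punchIn j c) ℤ.* v (punchIn j c))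
    ≡⟨ cong₂ ℤ._+_ (cong (s j ℤ.*_) (insertAt-lookup (λ c → r j ℤ.* w c) j _))
         (sum-cong-≗ (λ c → cong (s (punchIn j c) ℤ.*_) (insertAt-punchIn (λ c → r j ℤ.* w c) j _ c))) ⟩
  s j ℤ.* ℤ.- ((r ∘ punchIn j) · w) ℤ.+ sum (λ c → s (punchIn j c) ℤ.* (r j ℤ.* w c))
    ≡⟨ cong (ℤ._+ sum (λ c → s (punchIn j c) ℤ.* (r j ℤ.* w c))) (trans (sym (ℤ.neg-distribʳ-* (s j) _)) (trans (ℤ.neg-distribˡ-* (s j) _) (*-distribˡ-sum (ℤ.- s j) (λ c → r (punchIn j c) ℤ.* w c)))) ⟩
  sum (λ c → ℤ.- s j ℤ.* (r (punchIn j c) ℤ.* w c)) ℤ.+ sum (λ c → s (punchIn j c) ℤ.* (r j ℤ.* w c))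
    ≡⟨ ∑-distrib-+ (λ c → ℤ.- s j ℤ.* (r (punchIn j c) ℤ.* w c)) _ ⟨
  sum (λ c → ℤ.- s j ℤ.* (r (punchIn j c) ℤ.* w c) ℤ.+ s (punchIn j c) ℤ.* (r j ℤ.* w c))
    ≡⟨ sum-cong-≗ (λ c → regroup (s j) (r (punchIn j c)) (w c) (s (punchIn j c)) (r j)) ⟩
  eliminate j r s · w ∎
  where
  v = backSubstitute j r w
  regroup : ∀ a b c d e → ℤ.- a ℤ.* (b ℤ.* c) ℤ.+ d ℤ.* (e ℤ.* c) ≡ (e ℤ.* d ℤ.- a ℤ.* b) ℤ.* c
  regroup = ℤSolver.solve-∀

-- Gaussian elimination: a zero row is dropped, any other row supplies a pivot and costs one column.
-- The recursion is on the bound `m`, since the eliminated rows are not a sublist of the given ones.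
nonzero-kernel-vector : ∀ {n} m (rows : List (Fin n → ℤ)) → length rows ≤ m → m < n →
  Σ (Fin n → ℤ) λ v → (∃[ p ] v p ≢ 0ℤ) × All (λ r → r · v ≡ 0ℤ) rows
nonzero-kernel-vector {suc n} m [] _ _ = (λ _ → 1ℤ) , (zero , λ ()) , []
nonzero-kernel-vector {suc n} (suc m) (r ∷ rows) (s≤s len≤m) (s≤s m<n) with any? (λ j → ¬? (r j ℤ.≟ 0ℤ))
... | no r≡0 =
  let v , nz , ker = nonzero-kernel-vector m rows len≤m (ℕ.m<n⇒m<1+n m<n)
  in  v , nz , sum-zero (λ j → cong (ℤ._* v j) (decidable-stable (r j ℤ.≟ 0ℤ) (λ ne → r≡0 (j , ne)))) ∷ ker
... | yes (j , rj≢0)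
  with w , (p , wp≢0) , ker ←
    nonzero-kernel-vector m (map (eliminate j r) rows) (subst (_≤ m) (sym (List.length-map _ rows)) len≤m) m<n
  = backSubstitute j r w , (punchIn j p , nz) ,
    head-eq ∷ All.map (λ {s} → trans (·-backSubstitute j r s w)) (All.map⁻ ker)
  where
  nz : backSubstitute j r w (punchIn j p) ≢ 0ℤ
  nz eq with ℤ.i*j≡0⇒i≡0∨j≡0 (r j) (trans (sym (insertAt-punchIn _ j _ p)) eq)
  ... | inj₁ e = rj≢0 e
  ... | inj₂ e = wp≢0 e
  head-eq : r · backSubstitute j r w ≡ 0ℤ
  head-eq = trans (·-backSubstitute j r r w)
    (sum-zero (λ c → cong (ℤ._* w c) (ℤ.+-inverseʳ (r j ℤ.* r (punchIn j c)))))

∣sum⇒∣term : ∀ {n d} {f : Fin n → ℤ} i → d ℤ∣.∣ sum f → (∀ j → j ≢ i → d ℤ∣.∣ f j) → d ℤ∣.∣ f i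
∣sum⇒∣term {suc n} {d} {f} i d∣sum d∣rest =
  ℤ∣.∣m+n∣n⇒∣m (subst (d ℤ∣.∣_) (sum-remove {i = i} f) d∣sum) (∣-sum (λ j → d∣rest (punchIn i j) (punchInᵢ≢i i j)))
  where
  ∣-sum : ∀ {m} {g : Fin m → ℤ} → (∀ j → d ℤ∣.∣ g j) → d ℤ∣.∣ sum g
  ∣-sum {zero}  _   = divides 0ℤ refl
  ∣-sum {suc m} d∣g = ℤ∣.∣m∣n⇒∣m+n (d∣g zero) (∣-sum (d∣g ∘ suc))

-- Multilinear polynomials of bounded degree

Δ : ∀ {n} → (Vec Bool (suc n) → ℤ) → Vec Bool n → ℤ
Δ f y = f (true ∷ y) ℤ.- f (false ∷ y)

-- Every `f` on the cube splits as `f (b ∷ y) = f (false ∷ y) + b * Δ f y`, so degree can be read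
-- off the values of `f` by recursion on the coordinates, without a syntax of polynomials.
Deg≤ : ∀ {n} → ℕ → (Vec Bool n → ℤ) → Set
Deg≤         zero    f = ∀ x y → f x ≡ f y
Deg≤ {zero}  (suc t) f = ⊤
Deg≤ {suc n} (suc t) f = Deg≤ (suc t) (f ∘ (false ∷_)) × Deg≤ t (Δ f)

Deg≤-resp-≗ : ∀ {n} t {f g : Vec Bool n → ℤ} → f ≗ g → Deg≤ t f → Deg≤ t g
Deg≤-resp-≗         zero    f≗g df x y = trans (sym (f≗g x)) (trans (df x y) (f≗g y))
Deg≤-resp-≗ {zero}  (suc t) f≗g df = tt
Deg≤-resp-≗ {suc n} (suc t) f≗g (df , dΔ) =
  Deg≤-resp-≗ (suc t) (λ y → f≗g (false ∷ y)) df ,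
  Deg≤-resp-≗ t (λ y → cong₂ ℤ._-_ (f≗g (true ∷ y)) (f≗g (false ∷ y))) dΔ

Deg≤-+ : ∀ {n} t {f g : Vec Bool n → ℤ} → Deg≤ t f → Deg≤ t g → Deg≤ t (λ y → f y ℤ.+ g y)
Deg≤-+         zero    df dg x y = cong₂ ℤ._+_ (df x y) (dg x y)
Deg≤-+ {zero}  (suc t) df dg = tt
Deg≤-+ {suc n} (suc t) {f} {g} (df , dΔf) (dg , dΔg) =
  Deg≤-+ (suc t) df dg ,
  Deg≤-resp-≗ t (λ y → shuffle (f (true ∷ y)) (f (false ∷ y)) (g (true ∷ y)) (g (false ∷ y))) (Deg≤-+ t dΔf dΔg)
  where
  shuffle : ∀ a b c d → a ℤ.- b ℤ.+ (c ℤ.- d) ≡ a ℤ.+ c ℤ.- (b ℤ.+ d)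
  shuffle = ℤSolver.solve-∀

Deg≤-scale : ∀ {n} t c {f : Vec Bool n → ℤ} → Deg≤ t f → Deg≤ t (λ y → c ℤ.* f y)
Deg≤-scale         zero    c df x y = cong (c ℤ.*_) (df x y)
Deg≤-scale {zero}  (suc t) c df = tt
Deg≤-scale {suc n} (suc t) c {f} (df , dΔ) =
  Deg≤-scale (suc t) c df ,
  Deg≤-resp-≗ t (λ y → distrib c (f (true ∷ y)) (f (false ∷ y))) (Deg≤-scale t c dΔ)
  where
  distrib : ∀ a b c → a ℤ.* (b ℤ.- c) ≡ a ℤ.* b ℤ.- a ℤ.* c
  distrib = ℤSolver.solve-∀

Deg≤-suc : ∀ {n} t {f : Vec Bool n → ℤ} → Deg≤ t f → Deg≤ (suc t) f
Deg≤-suc {zero}  t       df = tt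
Deg≤-suc {suc n} zero    df =
  Deg≤-suc zero (λ x y → df (false ∷ x) (false ∷ y)) ,
  λ x y → cong₂ ℤ._-_ (df (true ∷ x) (true ∷ y)) (df (false ∷ x) (false ∷ y))
Deg≤-suc {suc n} (suc t) (df , dΔ) = Deg≤-suc (suc t) df , Deg≤-suc t dΔ

Deg≤-*-constant : ∀ {n} t {f g : Vec Bool n → ℤ} → Deg≤ t f → Deg≤ 0 g → Deg≤ t (λ y → f y ℤ.* g y)
Deg≤-*-constant {n} t {f} {g} df dg =
  Deg≤-resp-≗ t (λ y → trans (ℤ.*-comm _ (f y)) (cong (f y ℤ.*_) (dg _ y)))
    (Deg≤-scale t (g (replicate n false)) df)

-- Product rule with `f₀`, `g₀` the restrictions to first bit `false`: `Δ (f g) = Δ f * g₀ + f₀ * Δ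
-- g + Δ f * Δ g`. Since `g` is affine, `Δ g` is constant, so only the first summand needs the
-- induction hypothesis.
Deg≤-*-affine : ∀ {n} t {f g : Vec Bool n → ℤ} → Deg≤ t f → Deg≤ 1 g → Deg≤ (suc t) (λ y → f y ℤ.* g y)
Deg≤-*-affine         zero    {f} {g} df dg =
  Deg≤-resp-≗ 1 (λ y → ℤ.*-comm (g y) (f y)) (Deg≤-*-constant 1 dg df)
Deg≤-*-affine {zero}  (suc t) df dg = tt
Deg≤-*-affine {suc n} (suc t) {f} {g} (df , dΔf) (dg , dΔg) =
  Deg≤-*-affine (suc t) df dg ,
  Deg≤-resp-≗ (suc t) (λ y → leibniz (f (true ∷ y)) (f (false ∷ y)) (g (true ∷ y)) (g (false ∷ y)))
    (Deg≤-+ (suc t)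
      (Deg≤-+ (suc t) (Deg≤-*-affine t dΔf dg) (Deg≤-*-constant (suc t) df dΔg))
      (Deg≤-suc t (Deg≤-*-constant t dΔf dΔg)))
  where
  leibniz : ∀ a b c d → (a ℤ.- b) ℤ.* d ℤ.+ b ℤ.* (c ℤ.- d) ℤ.+ (a ℤ.- b) ℤ.* (c ℤ.- d) ≡ a ℤ.* c ℤ.- b ℤ.* d
  leibniz = ℤSolver.solve-∀

bit : Bool → ℤ
bit false = 0ℤ
bit true  = 1ℤ

-- The squarefree monomials of degree at most `t`: first those without the leading coordinate, then
-- those divisible by it.
monomials : ∀ n → ℕ → List (Vec Bool n → ℤ)
monomials zero    _       = (λ _ → 1ℤ) ∷ []
monomials (suc n) zero    = (λ _ → 1ℤ) ∷ []
monomials (suc n) (suc t) =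
  map (_∘ tail) (monomials n (suc t)) ++ map (λ m y → bit (head y) ℤ.* m (tail y)) (monomials n t)

-- This is `C(n,0) + ... + C(n,t)`, given by the Pascal recursion that `monomials` follows.
dim : ℕ → ℕ → ℕ
dim zero    _       = 1
dim (suc n) zero    = 1
dim (suc n) (suc t) = dim n (suc t) + dim n t

length-monomials : ∀ n t → length (monomials n t) ≡ dim n t
length-monomials zero    t       = refl
length-monomials (suc n) zero    = refl
length-monomials (suc n) (suc t) = trans (List.length-++ (map _ (monomials n (suc t))))
  (cong₂ _+_ (trans (List.length-map _ (monomials n (suc t))) (length-monomials n (suc t)))
             (trans (List.length-map _ (monomials n t)) (length-monomials n t)))

constant-⊥ : ∀ {n N} (y : Fin N → Vec Bool n) (v : Fin N → ℤ) {f : Vec Bool n → ℤ} →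
             Deg≤ 0 f → (λ _ → 1ℤ) · v ≡ 0ℤ → (f ∘ y) · v ≡ 0ℤ
constant-⊥ {n} y v {f} df 1⊥v = begin
  sum (λ i → f (y i) ℤ.* v i)          ≡⟨ sum-cong-≗ (λ i → cong₂ ℤ._*_ (df (y i) _) (sym (ℤ.*-identityˡ (v i)))) ⟩
  sum (λ i → c ℤ.* (1ℤ ℤ.* v i))       ≡⟨ *-distribˡ-sum c (λ i → 1ℤ ℤ.* v i) ⟨
  c ℤ.* sum (λ i → 1ℤ ℤ.* v i)         ≡⟨ cong (c ℤ.*_) 1⊥v ⟩
  c ℤ.* 0ℤ                             ≡⟨ ℤ.*-zeroʳ c ⟩
  0ℤ                                   ∎
  where c = f (replicate n false)

-- Spanning in dual form, so that no coefficients of `f` have to be named. In the splitting of `f`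
-- along its first coordinate, the factor `bit (head y)` is moved onto `v`; the induction therefore
-- needs arbitrary `v` and arbitrary points `y`.
monomials-span : ∀ {n N} t (y : Fin N → Vec Bool n) (v : Fin N → ℤ) {f : Vec Bool n → ℤ} → Deg≤ t f →
  All (λ m → (m ∘ y) · v ≡ 0ℤ) (monomials n t) → (f ∘ y) · v ≡ 0ℤ
monomials-span {zero}  t       y v {f} df (1⊥v ∷ []) = constant-⊥ y v {f} (λ { [] [] → refl }) 1⊥v
monomials-span {suc n} zero    y v df (1⊥v ∷ []) = constant-⊥ y v df 1⊥v
monomials-span {suc n} (suc t) y v {f} (df , dΔ) ⊥v = begin
  (f ∘ y) · v
    ≡⟨ sum-cong-≗ (λ i → expand (y i) (v i)) ⟩
  sum (λ i → f₀ (tail (y i)) ℤ.* v i ℤ.+ Δ f (tail (y i)) ℤ.* (bit (head (y i)) ℤ.* v i))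
    ≡⟨ ∑-distrib-+ (λ i → f₀ (tail (y i)) ℤ.* v i) _ ⟩
  (f₀ ∘ tail ∘ y) · v ℤ.+ (Δ f ∘ tail ∘ y) · (λ i → bit (head (y i)) ℤ.* v i)
    ≡⟨ cong₂ ℤ._+_
         (monomials-span (suc t) (tail ∘ y) v df (All.map⁻ (All.++⁻ˡ (map _ (monomials n (suc t))) ⊥v)))
         (monomials-span t (tail ∘ y) _ dΔ
           (All.map (λ {m} eq → trans (sum-cong-≗ (λ i → assoc (m (tail (y i))) (bit (head (y i))) (v i))) eq)
             (All.map⁻ (All.++⁻ʳ (map _ (monomials n (suc t))) ⊥v)))) ⟩
  0ℤ ∎
  where
  f₀ = f ∘ (false ∷_)
  assoc : ∀ a b c → a ℤ.* (b ℤ.* c) ≡ b ℤ.* a ℤ.* c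
  assoc = ℤSolver.solve-∀
  at-true : ∀ a b c → a ℤ.* c ≡ b ℤ.* c ℤ.+ (a ℤ.- b) ℤ.* (1ℤ ℤ.* c)
  at-true = ℤSolver.solve-∀
  at-false : ∀ a b c → b ℤ.* c ≡ b ℤ.* c ℤ.+ (a ℤ.- b) ℤ.* (0ℤ ℤ.* c)
  at-false = ℤSolver.solve-∀
  expand : ∀ z c → f z ℤ.* c ≡ f₀ (tail z) ℤ.* c ℤ.+ Δ f (tail z) ℤ.* (bit (head z) ℤ.* c)
  expand (true  ∷ z) c = at-true (f (true ∷ z)) (f (false ∷ z)) c
  expand (false ∷ z) c = at-false (f (true ∷ z)) (f (false ∷ z)) c

-- Binomial coefficients

-- The ratio `(n - k) / (k + 1)` of consecutive binomials, with the subtraction moved across so that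
-- `k > n` is covered. It yields absorption, the values of `dist-poly` and the growth estimates.
1+k*nC[1+k]+k*nCk≡n*nCk : ∀ n k → suc k * (n C suc k) + k * (n C k) ≡ n * (n C k)
1+k*nC[1+k]+k*nCk≡n*nCk zero    zero    = refl
1+k*nC[1+k]+k*nCk≡n*nCk zero    (suc k) = cong₂ _+_ (ℕ.*-zeroʳ (suc (suc k))) (ℕ.*-zeroʳ (suc k))
1+k*nC[1+k]+k*nCk≡n*nCk (suc n) zero    = trans (cong (λ z → 1 * z + 0) (nC1≡n (suc n))) (unit (suc n))
  where
  unit : ∀ n → 1 * n + 0 ≡ n * 1
  unit = ℕSolver.solve-∀
1+k*nC[1+k]+k*nCk≡n*nCk (suc n) (suc k) = begin
  suc (suc k) * (suc n C suc (suc k)) + suc k * (suc n C suc k)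
    ≡⟨ cong₂ (λ x y → suc (suc k) * x + suc k * y) (nCk+nC[k+1]≡[n+1]C[k+1] n (suc k)) (nCk+nC[k+1]≡[n+1]C[k+1] n k) ⟨
  suc (suc k) * (b + c) + suc k * (a + b)
    ≡⟨ split k a b c ⟩
  (suc (suc k) * c + suc k * b) + (suc k * b + k * a) + (a + b)
    ≡⟨ cong₂ (λ x y → x + y + (a + b)) (1+k*nC[1+k]+k*nCk≡n*nCk n (suc k)) (1+k*nC[1+k]+k*nCk≡n*nCk n k) ⟩
  n * b + n * a + (a + b)
    ≡⟨ merge n a b ⟩
  suc n * (a + b)
    ≡⟨ cong (suc n *_) (nCk+nC[k+1]≡[n+1]C[k+1] n k) ⟩
  suc n * (suc n C suc k) ∎
  where
  a = n C k
  b = n C suc k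
  c = n C suc (suc k)
  split : ∀ k a b c → suc (suc k) * (b + c) + suc k * (a + b) ≡ (suc (suc k) * c + suc k * b) + (suc k * b + k * a) + (a + b)
  split = ℕSolver.solve-∀
  merge : ∀ n a b → n * b + n * a + (a + b) ≡ suc n * (a + b)
  merge = ℕSolver.solve-∀

absorption : ∀ n k → suc k * (suc n C suc k) ≡ suc n * (n C k)
absorption n k = begin
  suc k * (suc n C suc k)                      ≡⟨ cong (suc k *_) (nCk+nC[k+1]≡[n+1]C[k+1] n k) ⟨
  suc k * (n C k + n C suc k)                  ≡⟨ regroup k (n C k) (n C suc k) ⟩
  n C k + (suc k * (n C suc k) + k * (n C k))  ≡⟨ cong (_+_ (n C k)) (1+k*nC[1+k]+k*nCk≡n*nCk n k) ⟩
  suc n * (n C k)                              ∎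
  where
  regroup : ∀ k a b → suc k * (a + b) ≡ a + (suc k * b + k * a)
  regroup = ℕSolver.solve-∀

-- If `n` is odd, each factor 2 must come from `m`; they are cancelled one at a time.
2^a∣m*n⇒2^a∣m⊎2∣n : ∀ a m n → 2 ^ a ∣ m * n → 2 ^ a ∣ m ⊎ 2 ∣ n
2^a∣m*n⇒2^a∣m⊎2∣n zero    m n _ = inj₁ (1∣ m)
2^a∣m*n⇒2^a∣m⊎2∣n (suc a) m n 2^1+a∣mn
  with euclidsLemma m n prime[2] (∣-trans (m∣m*n (2 ^ a)) 2^1+a∣mn)
... | inj₂ 2∣n = inj₂ 2∣n
... | inj₁ (divides m′ refl)
  with 2^a∣m*n⇒2^a∣m⊎2∣n a m′ n (*-cancelˡ-∣ 2 (subst (2 ^ suc a ∣_) (regroup m′ n) 2^1+a∣mn))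
  where
  regroup : ∀ m n → m * 2 * n ≡ 2 * (m * n)
  regroup = ℕSolver.solve-∀
... | inj₂ 2∣n    = inj₂ 2∣n
... | inj₁ 2^a∣m′ = inj₁ (subst (2 ^ suc a ∣_) (ℕ.*-comm 2 m′) (*-monoʳ-∣ 2 2^a∣m′))

-- By absorption `2 ^ a` divides `(j + 1) * C(j,t)`, so an odd `C(j,t)` would force `2 ^ a` to
-- divide `j + 1`. The upper bound uses the shape of `t` only here.
binomial-even : ∀ a t j → suc t ≡ 2 ^ a → ¬ 2 ^ a ∣ suc j → 2 ∣ j C t
binomial-even a t j t+1≡2^a 2^a∤j+1 with 2^a∣m*n⇒2^a∣m⊎2∣n a (suc j) (j C t)
  (subst₂ _∣_ t+1≡2^a (absorption j t) (m∣m*n (suc j C suc t)))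
... | inj₁ 2^a∣j+1 = contradiction 2^a∣j+1 2^a∤j+1
... | inj₂ 2∣jCt   = 2∣jCt

-- The distance polynomial

dist-poly : ℕ → ℤ → ℤ
dist-poly zero    d = 1ℤ
dist-poly (suc t) d = dist-poly t d ℤ.* (d ℤ.- + (2 * suc t))

2^t*t! : ℕ → ℕ
2^t*t! zero    = 1
2^t*t! (suc t) = 2^t*t! t * (2 * suc t)

2^t*t!-nonZero : ∀ t → NonZero (2^t*t! t)
2^t*t!-nonZero zero    = _
2^t*t!-nonZero (suc t) = ℕ.m*n≢0 (2^t*t! t) (2 * suc t) {{2^t*t!-nonZero t}}

-- The factors are `-2i` for `i` from 1 to `t`. Divisibility ignores the sign, so it is not tracked.
∣dist-poly-0∣ : ∀ t → ℤ.∣ dist-poly t 0ℤ ∣ ≡ 2^t*t! t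
∣dist-poly-0∣ zero    = refl
∣dist-poly-0∣ (suc t) = trans (ℤ.abs-* (dist-poly t 0ℤ) (0ℤ ℤ.- + (2 * suc t)))
  (cong (_* (2 * suc t)) (∣dist-poly-0∣ t))

-- The new factor is `2 (j - t)`, and `(j - t) * C(j,t) = (t + 1) * C(j,t+1)`. Over ℤ this is also
-- correct for `j < t`.
dist-poly-even : ∀ t j → dist-poly t (+ (2 * suc j)) ≡ + (2^t*t! t * (j C t))
dist-poly-even zero    j = refl
dist-poly-even (suc t) j = begin
  dist-poly t (+ (2 * suc j)) ℤ.* (+ (2 * suc j) ℤ.- + (2 * suc t))
    ≡⟨ cong (ℤ._* (+ (2 * suc j) ℤ.- + (2 * suc t))) (trans (dist-poly-even t j) (ℤ.pos-* (2^t*t! t) (j C t))) ⟩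
  K ℤ.* c ℤ.* (+ (2 * suc j) ℤ.- + (2 * suc t))
    ≡⟨ cong₂ (λ x y → K ℤ.* c ℤ.* (x ℤ.- y)) (ℤ.pos-* 2 (suc j)) (ℤ.pos-* 2 (suc t)) ⟩
  K ℤ.* c ℤ.* (+ 2 ℤ.* (1ℤ ℤ.+ J) ℤ.- + 2 ℤ.* (1ℤ ℤ.+ T))
    ≡⟨ expand K c J T (+ 2) ⟩
  K ℤ.* + 2 ℤ.* (J ℤ.* c ℤ.- T ℤ.* c)
    ≡⟨ cong (λ z → K ℤ.* + 2 ℤ.* (z ℤ.- T ℤ.* c)) recurrence ⟨
  K ℤ.* + 2 ℤ.* ((1ℤ ℤ.+ T) ℤ.* c′ ℤ.+ T ℤ.* c ℤ.- T ℤ.* c)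
    ≡⟨ collect K c c′ T (+ 2) ⟩
  K ℤ.* (+ 2 ℤ.* (1ℤ ℤ.+ T)) ℤ.* c′
    ≡⟨ cong (λ z → K ℤ.* z ℤ.* c′) (ℤ.pos-* 2 (suc t)) ⟨
  K ℤ.* + (2 * suc t) ℤ.* c′
    ≡⟨ cong (ℤ._* c′) (ℤ.pos-* (2^t*t! t) (2 * suc t)) ⟨
  + 2^t*t! (suc t) ℤ.* c′
    ≡⟨ ℤ.pos-* (2^t*t! (suc t)) (j C suc t) ⟨
  + (2^t*t! (suc t) * (j C suc t)) ∎
  where
  K = + 2^t*t! t
  c = + (j C t)
  c′ = + (j C suc t)
  J = + j
  T = + t
  expand : ∀ K c J T t → K ℤ.* c ℤ.* (t ℤ.* (1ℤ ℤ.+ J) ℤ.- t ℤ.* (1ℤ ℤ.+ T)) ≡ K ℤ.* t ℤ.* (J ℤ.* c ℤ.- T ℤ.* c)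
  expand = ℤSolver.solve-∀
  collect : ∀ K c c′ T t → K ℤ.* t ℤ.* ((1ℤ ℤ.+ T) ℤ.* c′ ℤ.+ T ℤ.* c ℤ.- T ℤ.* c) ≡ K ℤ.* (t ℤ.* (1ℤ ℤ.+ T)) ℤ.* c′
  collect = ℤSolver.solve-∀
  recurrence : (1ℤ ℤ.+ T) ℤ.* c′ ℤ.+ T ℤ.* c ≡ J ℤ.* c
  recurrence = begin
    + suc t ℤ.* c′ ℤ.+ T ℤ.* c                    ≡⟨ cong₂ ℤ._+_ (ℤ.pos-* (suc t) (j C suc t)) (ℤ.pos-* t (j C t)) ⟨
    + (suc t * (j C suc t) + t * (j C t))         ≡⟨ cong +_ (1+k*nC[1+k]+k*nCk≡n*nCk j t) ⟩
    + (j * (j C t))                               ≡⟨ ℤ.pos-* j (j C t) ⟩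
    J ℤ.* c                                       ∎

-- Flipping a bit of `y` changes the distance by 1 or -1, with a sign that depends only on the bit
-- of `x` there.
hamming-Deg≤1 : ∀ {n} (x : Vec Bool n) → Deg≤ 1 (λ y → + hamming x y)
hamming-Deg≤1 []          = _
hamming-Deg≤1 (true  ∷ x) =
  Deg≤-+ 1 {λ _ → 1ℤ} (Deg≤-suc 0 (λ _ _ → refl)) (hamming-Deg≤1 x) ,
  λ y z → trans (drop (+ hamming x y)) (sym (drop (+ hamming x z)))
  where
  drop : ∀ h → h ℤ.- (1ℤ ℤ.+ h) ≡ ℤ.- 1ℤ
  drop = ℤSolver.solve-∀
hamming-Deg≤1 (false ∷ x) =
  hamming-Deg≤1 x ,
  λ y z → trans (gain (+ hamming x y)) (sym (gain (+ hamming x z)))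
  where
  gain : ∀ h → 1ℤ ℤ.+ h ℤ.- h ≡ 1ℤ
  gain = ℤSolver.solve-∀

dist-poly-Deg≤ : ∀ {n} t (x : Vec Bool n) → Deg≤ t (λ y → dist-poly t (+ hamming x y))
dist-poly-Deg≤ zero    x = λ _ _ → refl
dist-poly-Deg≤ (suc t) x = Deg≤-*-affine t (dist-poly-Deg≤ t x)
  (Deg≤-+ 1 {g = λ _ → ℤ.- + (2 * suc t)} (hamming-Deg≤1 x) (Deg≤-suc 0 (λ _ _ → refl)))

hamming-refl : ∀ {n} (x : Vec Bool n) → hamming x x ≡ 0
hamming-refl []          = refl
hamming-refl (true  ∷ x) = hamming-refl x
hamming-refl (false ∷ x) = hamming-refl x

-- Two-adic descent and the bound for one parity class

HalfDistanceAvoids : ℕ → ∀ {n} → Vec Bool n → Vec Bool n → Set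
HalfDistanceAvoids m x y = ∃[ j ] hamming x y ≡ 2 * suc j × ¬ m ∣ suc j

module _ {t n N} a (t+1≡2^a : suc t ≡ 2 ^ a) (y : Fin N → Vec Bool n)
         (apart : ∀ {i j} → i ≢ j → HalfDistanceAvoids (2 ^ a) (y i) (y j)) where

  -- Orthogonality to the monomials imposes only `dim n t` equations, yet by `monomials-span` it
  -- implies that every row of the distance matrix annihilates `u`.
  Kernel : (Fin N → ℤ) → Set
  Kernel u = All (λ m → (m ∘ y) · u ≡ 0ℤ) (monomials n t)

  -- With `K = 2^t*t! t`, row `i` applied to `u` gives 0 and its off-diagonal terms are divisible by
  -- `2 * K`. Hence so is the diagonal term, which is `K * u i` up to sign, and `K` cancels.
  kernel-even : ∀ {u} → Kernel u → ∀ i → + 2 ℤ∣.∣ u i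
  kernel-even {u} ker i = ℤ∣.∣ᵤ⇒∣ (*-cancelˡ-∣ K {{2^t*t!-nonZero t}}
    (subst₂ _∣_ (ℕ.*-comm 2 K) diagonal (ℤ∣.∣⇒∣ᵤ (∣sum⇒∣term i 2K∣sum off-diagonal))))
    where
    K = 2^t*t! t
    term : Fin N → ℤ
    term j = dist-poly t (+ hamming (y i) (y j)) ℤ.* u j
    2K∣sum : + (2 * K) ℤ∣.∣ (λ j → dist-poly t (+ hamming (y i) (y j))) · u
    2K∣sum = divides 0ℤ (monomials-span t y u (dist-poly-Deg≤ t (y i)) ker)
    off-diagonal : ∀ j → j ≢ i → + (2 * K) ℤ∣.∣ term j
    off-diagonal j j≢i with apart (j≢i ∘ sym)
    ... | h , eq , 2^a∤h+1 rewrite eq | dist-poly-even t h =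
      ℤ∣.∣m⇒∣m*n {m = + (K * (h C t))} (u j) (ℤ∣.∣ᵤ⇒∣ (subst (_∣ K * (h C t)) (ℕ.*-comm K 2) (*-monoʳ-∣ K (binomial-even a t h t+1≡2^a 2^a∤h+1))))
    diagonal : ℤ.∣ term i ∣ ≡ K * ℤ.∣ u i ∣
    diagonal = trans (ℤ.abs-* (dist-poly t (+ hamming (y i) (y i))) (u i))
      (cong (_* ℤ.∣ u i ∣) (trans (cong (λ d → ℤ.∣ dist-poly t (+ d) ∣) (hamming-refl (y i))) (∣dist-poly-0∣ t)))

  -- Descent: `u = 2 w` with `w` again in the kernel. Halving a nonzero entry strictly lowers its
  -- absolute value, so the bound `b` drops by one each time and reaches zero.
  kernel-trivial : ∀ b {u} → Kernel u → ∀ p → ℤ.∣ u p ∣ ≤ b → u p ≡ 0ℤ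
  kernel-trivial zero    ker p up≤b = ℤ.∣i∣≡0⇒i≡0 (ℕ.n≤0⇒n≡0 up≤b)
  kernel-trivial (suc b) {u} ker p up≤b =
    trans (half p) (cong (+ 2 ℤ.*_) (kernel-trivial b {w} (All.map (λ {m} → halve m) ker) p
      (halve-≤ ℤ.∣ w p ∣ (subst (_≤ suc b) (trans (cong ℤ.∣_∣ (half p)) (ℤ.abs-* (+ 2) (w p))) up≤b))))
    where
    w : Fin N → ℤ
    w i = ℤ∣.quotient (kernel-even {u} ker i)
    half : ∀ i → u i ≡ + 2 ℤ.* w i
    half i = trans (ℤ∣._∣_.equality (kernel-even {u} ker i)) (ℤ.*-comm (w i) (+ 2))
    halve : ∀ m → (m ∘ y) · u ≡ 0ℤ → (m ∘ y) · w ≡ 0ℤ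
    halve m eq = [ (λ ()) , (λ e → e) ]′ (ℤ.i*j≡0⇒i≡0∨j≡0 (+ 2)
      (trans (sym (trans (·-congʳ (m ∘ y) half) (·-scaleʳ (+ 2) (m ∘ y) w))) eq))
    halve-≤ : ∀ x → 2 * x ≤ suc b → x ≤ b
    halve-≤ zero    _  = z≤n
    halve-≤ (suc x) le = ℕ.≤-trans (ℕ.≤-trans (ℕ.m≤m+n (suc x) (x + 0)) (ℕ.≤-reflexive (sym (ℕ.+-suc x (x + 0))))) (ℕ.≤-pred le)

  -- With more points than monomials, elimination would produce a nonzero kernel vector, against the
  -- descent.
  size≤dim : N ≤ dim n t
  size≤dim = ℕ.≮⇒≥ λ dim<N →
    let v , (p , vp≢0) , ker = nonzero-kernel-vector (dim n t) (map (_∘ y) (monomials n t))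
          (ℕ.≤-reflexive (trans (List.length-map (_∘ y) (monomials n t)) (length-monomials n t))) dim<N
    in  vp≢0 (kernel-trivial ℤ.∣ v p ∣ (All.map⁻ ker) p ℕ.≤-refl)

lookup-injective : ∀ {A : Set} {xs : List A} → Unique xs → ∀ {i j} → lookup xs i ≡ lookup xs j → i ≡ j
lookup-injective (_  ∷ _) {zero}  {zero}  _  = refl
lookup-injective (x∉ ∷ _) {zero}  {suc j} eq = contradiction eq (All.lookup x∉ (∈-lookup j))
lookup-injective (x∉ ∷ _) {suc i} {zero}  eq = contradiction (sym eq) (All.lookup x∉ (∈-lookup i))
lookup-injective (_  ∷ u) {suc i} {suc j} eq = cong suc (lookup-injective u eq)

length≤dim : ∀ {t n} a → suc t ≡ 2 ^ a → (ys : List (Vec Bool n)) → Unique ys →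
  (∀ {x y} → x ∈ ys → y ∈ ys → x ≢ y → HalfDistanceAvoids (2 ^ a) x y) → length ys ≤ dim n t
length≤dim a t+1≡2^a ys uniq apart = size≤dim a t+1≡2^a (lookup ys)
  (λ i≢j → apart (∈-lookup _) (∈-lookup _) (i≢j ∘ lookup-injective uniq))

-- Parity classes

weight : ∀ {n} → Vec Bool n → ℕ
weight []          = 0
weight (true  ∷ x) = suc (weight x)
weight (false ∷ x) = weight x

-- The witness is the number of common ones.
hamming+2m≡weights : ∀ {n} (x y : Vec Bool n) → ∃[ m ] 2 * m + hamming x y ≡ weight x + weight y
hamming+2m≡weights []          []          = 0 , refl
hamming+2m≡weights (true  ∷ x) (true  ∷ y) with m , eq ← hamming+2m≡weights x y =
  suc m , trans (cong (_+ hamming x y) (ℕ.*-suc 2 m)) (cong suc (trans (cong suc eq) (sym (ℕ.+-suc (weight x) (weight y)))))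
hamming+2m≡weights (true  ∷ x) (false ∷ y) with m , eq ← hamming+2m≡weights x y =
  m , trans (ℕ.+-suc (2 * m) _) (cong suc eq)
hamming+2m≡weights (false ∷ x) (true  ∷ y) with m , eq ← hamming+2m≡weights x y =
  m , trans (ℕ.+-suc (2 * m) _) (trans (cong suc eq) (sym (ℕ.+-suc (weight x) (weight y))))
hamming+2m≡weights (false ∷ x) (false ∷ y) = hamming+2m≡weights x y

hamming-even : ∀ {n} (x y : Vec Bool n) → 2 ∣ weight x + weight y → 2 ∣ hamming x y
hamming-even x y 2∣w with m , eq ← hamming+2m≡weights x y = ∣m+n∣m⇒∣n (subst (2 ∣_) (sym eq) 2∣w) (m∣m*n m)

2∤n⇒2∣1+n : ∀ n → ¬ 2 ∣ n → 2 ∣ suc n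
2∤n⇒2∣1+n zero          2∤n = contradiction (divides 0 refl) 2∤n
2∤n⇒2∣1+n (suc zero)    _   = ∣-refl
2∤n⇒2∣1+n (suc (suc n)) 2∤n = ∣m∣n⇒∣m+n ∣-refl (2∤n⇒2∣1+n n (2∤n ∘ ∣m∣n⇒∣m+n ∣-refl))

2∣m+n-odd : ∀ m n → ¬ 2 ∣ m → ¬ 2 ∣ n → 2 ∣ m + n
2∣m+n-odd m n 2∤m 2∤n = ∣m+n∣m⇒∣n
  (subst (2 ∣_) (cong suc (ℕ.+-suc m n)) (∣m∣n⇒∣m+n (2∤n⇒2∣1+n m 2∤m) (2∤n⇒2∣1+n n 2∤n))) ∣-refl

length-filter-¬ : ∀ {A : Set} {P : Pred A 0ℓ} (P? : Decidable P) xs →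
  length xs ≡ length (filter P? xs) + length (filter (¬? ∘ P?) xs)
length-filter-¬ P? []       = refl
length-filter-¬ P? (x ∷ xs) with P? x
... | yes _ = cong suc (length-filter-¬ P? xs)
... | no  _ = trans (cong suc (length-filter-¬ P? xs)) (sym (ℕ.+-suc _ _))

-- If `2 ^ a` divided half the distance, `2 ^ suc a` would divide the distance; positivity makes the
-- half a successor.
even-distance-avoids : ∀ {n} a (x y : Vec Bool n) → 2 ∣ hamming x y →
  Lset (suc a) n (hamming x y) → HalfDistanceAvoids (2 ^ a) x y
even-distance-avoids a x y (divides zero eq) (1≤h , _) rewrite eq with () ← 1≤h
even-distance-avoids a x y (divides (suc j) eq) (_ , _ , ∤h) =
  j , eq′ , λ 2^a∣j+1 → ∤h (subst (2 ^ suc a ∣_) (sym eq′) (*-monoʳ-∣ 2 2^a∣j+1))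
  where eq′ = trans eq (ℕ.*-comm (suc j) 2)

code-size≤2*dim : ∀ {t n} a → suc t ≡ 2 ^ a → (c : Code (Lset (suc a) n) n) → length (words c) ≤ 2 * dim n t
code-size≤2*dim {t} {n} a t+1≡2^a c = subst₂ _≤_ (sym (length-filter-¬ even? (words c))) (double (dim n t))
  (ℕ.+-mono-≤
    (class-bound even? (λ x y ex ey → ∣m∣n⇒∣m+n ex ey))
    (class-bound (¬? ∘ even?) (λ x y → 2∣m+n-odd (weight x) (weight y))))
  where
  double : ∀ d → d + d ≡ 2 * d
  double = ℕSolver.solve-∀
  even? : (x : Vec Bool n) → Dec (2 ∣ weight x)
  even? x = 2 ∣? weight x
  -- Only the parity of the sum of two weights matters, so one argument serves the even and the odd
  -- class.
  class-bound : {P : Pred (Vec Bool n) 0ℓ} (P? : Decidable P) →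
    (∀ x y → P x → P y → 2 ∣ weight x + weight y) → length (filter P? (words c)) ≤ dim n t
  class-bound P? even = length≤dim a t+1≡2^a (filter P? (words c)) (Unique.filter⁺ P? (distinct c))
    λ {x} {y} x∈ y∈ x≢y →
      let x∈c , Px = ∈-filter⁻ P? x∈
          y∈c , Py = ∈-filter⁻ P? y∈
      in  even-distance-avoids a x y (hamming-even x y (even x y Px Py)) (dists c x∈c y∈c x≢y)

-- Constant-weight words

ofWeight : ∀ n → ℕ → List (Vec Bool n)
ofWeight zero    zero    = [] ∷ []
ofWeight zero    (suc t) = []
ofWeight (suc n) zero    = map (false ∷_) (ofWeight n zero)
ofWeight (suc n) (suc t) = map (true ∷_) (ofWeight n t) ++ map (false ∷_) (ofWeight n (suc t))

length-ofWeight : ∀ n t → length (ofWeight n t) ≡ n C t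
length-ofWeight zero    zero    = refl
length-ofWeight zero    (suc t) = refl
length-ofWeight (suc n) zero    = trans (List.length-map _ (ofWeight n zero)) (length-ofWeight n zero)
length-ofWeight (suc n) (suc t) = begin
  length (map (true ∷_) (ofWeight n t) ++ map (false ∷_) (ofWeight n (suc t)))
    ≡⟨ List.length-++ (map (true ∷_) (ofWeight n t)) ⟩
  length (map (true ∷_) (ofWeight n t)) + length (map (false ∷_) (ofWeight n (suc t)))
    ≡⟨ cong₂ _+_ (trans (List.length-map _ (ofWeight n t)) (length-ofWeight n t))
                 (trans (List.length-map _ (ofWeight n (suc t))) (length-ofWeight n (suc t))) ⟩
  n C t + n C suc t
    ≡⟨ nCk+nC[k+1]≡[n+1]C[k+1] n t ⟩
  suc n C suc t ∎

∷-injective : ∀ {n b} {x y : Vec Bool n} → b ∷ x ≡ b ∷ y → x ≡ y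
∷-injective refl = refl

-- The leading bit keeps the two halves disjoint. This serves both the recursion of `ofWeight` and
-- the two layers of the code.
Unique-prefixed : ∀ {n} {xs ys : List (Vec Bool n)} → Unique xs → Unique ys →
  Unique (map (true ∷_) xs ++ map (false ∷_) ys)
Unique-prefixed ux uy = Unique.++⁺ (Unique.map⁺ ∷-injective ux) (Unique.map⁺ ∷-injective uy) disjoint
  where
  disjoint : ∀ {v} → ¬ (v ∈ map (true ∷_) _ × v ∈ map (false ∷_) _)
  disjoint (v∈t , v∈f) with _ , _ , refl ← ∈-map⁻ _ v∈t | _ , _ , () ← ∈-map⁻ _ v∈f

ofWeight-unique : ∀ n t → Unique (ofWeight n t)
ofWeight-unique zero    zero    = [] ∷ []
ofWeight-unique zero    (suc t) = []
ofWeight-unique (suc n) zero    = Unique.map⁺ ∷-injective (ofWeight-unique n zero)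
ofWeight-unique (suc n) (suc t) = Unique-prefixed (ofWeight-unique n t) (ofWeight-unique n (suc t))

∈-ofWeight : ∀ n t {x} → x ∈ ofWeight n t → weight x ≡ t
∈-ofWeight zero    zero    (here refl) = refl
∈-ofWeight (suc n) zero    x∈ with _ , x∈′ , refl ← ∈-map⁻ _ x∈ = ∈-ofWeight n zero x∈′
∈-ofWeight (suc n) (suc t) x∈ with ∈-++⁻ (map (true ∷_) (ofWeight n t)) x∈
... | inj₁ x∈t with _ , x∈′ , refl ← ∈-map⁻ _ x∈t = cong suc (∈-ofWeight n t x∈′)
... | inj₂ x∈f with _ , x∈′ , refl ← ∈-map⁻ _ x∈f = ∈-ofWeight n (suc t) x∈′

hamming≡0⇒≡ : ∀ {n} (x y : Vec Bool n) → hamming x y ≡ 0 → x ≡ y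
hamming≡0⇒≡ []          []          _  = refl
hamming≡0⇒≡ (true  ∷ x) (true  ∷ y) eq = cong (true ∷_) (hamming≡0⇒≡ x y eq)
hamming≡0⇒≡ (false ∷ x) (false ∷ y) eq = cong (false ∷_) (hamming≡0⇒≡ x y eq)

hamming≤n : ∀ {n} (x y : Vec Bool n) → hamming x y ≤ n
hamming≤n []          []          = z≤n
hamming≤n (true  ∷ x) (true  ∷ y) = ℕ.m≤n⇒m≤1+n (hamming≤n x y)
hamming≤n (true  ∷ x) (false ∷ y) = s≤s (hamming≤n x y)
hamming≤n (false ∷ x) (true  ∷ y) = s≤s (hamming≤n x y)
hamming≤n (false ∷ x) (false ∷ y) = ℕ.m≤n⇒m≤1+n (hamming≤n x y)

two-layer-code : ∀ {t} a → suc t ≡ 2 ^ a → ∀ n → Σ (Code (Lset (suc a) (suc n)) (suc n)) λ c → length (words c) ≡ 2 * (n C t)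
two-layer-code {t} a t+1≡2^a n = record
  { words    = map (true ∷_) layer ++ map (false ∷_) layer
  ; distinct = Unique-prefixed (ofWeight-unique n t) (ofWeight-unique n t)
  ; dists    = λ {x} {y} x∈ y∈ x≢y → positive x y x≢y , hamming≤n x y , indivisible x∈ y∈ x≢y
  } , size
  where
  layer = ofWeight n t

  size : length (map (true ∷_) layer ++ map (false ∷_) layer) ≡ 2 * (n C t)
  size = trans (List.length-++ (map (true ∷_) layer))
    (cong₂ _+_ (trans (List.length-map _ layer) (length-ofWeight n t))
               (trans (List.length-map _ layer) (trans (length-ofWeight n t) (sym (ℕ.+-identityʳ _)))))

  positive : ∀ {m} (x y : Vec Bool m) → x ≢ y → 1 ≤ hamming x y
  positive x y x≢y = ℕ.n≢0⇒n>0 (x≢y ∘ hamming≡0⇒≡ x y)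

  layer-weights : ∀ {x y} → x ∈ layer → y ∈ layer → weight x + weight y ≡ 2 * t
  layer-weights x∈ y∈ = cong₂ _+_ (∈-ofWeight n t x∈) (trans (∈-ofWeight n t y∈) (sym (ℕ.+-identityʳ t)))

  same-layer : ∀ {x y} → x ∈ layer → y ∈ layer → x ≢ y → ¬ 2 ^ suc a ∣ hamming x y
  -- The distance is positive and at most `2 * t < 2 * suc t = 2 ^ suc a`, hence no multiple of
  -- `2 ^ suc a`.
  same-layer {x} {y} x∈ y∈ x≢y = >⇒∤ {{>-nonZero (positive x y x≢y)}}
    (ℕ.≤-<-trans (ℕ.≤-trans (ℕ.m≤n+m _ (2 * m)) (ℕ.≤-reflexive (trans eq (layer-weights x∈ y∈))))
      (subst (λ z → 2 * t < 2 * z) t+1≡2^a (ℕ.*-monoʳ-< 2 (ℕ.n<1+n t))))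
    where
    m  = proj₁ (hamming+2m≡weights x y)
    eq = proj₂ (hamming+2m≡weights x y)

  cross-layer : ∀ {x y} → x ∈ layer → y ∈ layer → ¬ 2 ^ suc a ∣ suc (hamming x y)
  -- Equal weights make `hamming x y` even, so the full distance is odd; an even divisor of it would
  -- give `2 ∣ 1`.
  cross-layer {x} {y} x∈ y∈ ∣1+h = contradiction
    (∣m+n∣m⇒∣n (subst (2 ∣_) (ℕ.+-comm 1 (hamming x y)) (∣-trans (m∣m*n (2 ^ a)) ∣1+h))
      (hamming-even x y (subst (2 ∣_) (sym (layer-weights x∈ y∈)) (m∣m*n t))))
    (>⇒∤ (s≤s (s≤s z≤n)))

  indivisible : ∀ {x y} → x ∈ map (true ∷_) layer ++ map (false ∷_) layer →
    y ∈ map (true ∷_) layer ++ map (false ∷_) layer → x ≢ y → ¬ 2 ^ suc a ∣ hamming x y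
  indivisible x∈ y∈ x≢y with ∈-++⁻ (map (true ∷_) layer) x∈ | ∈-++⁻ (map (true ∷_) layer) y∈
  ... | inj₁ p | inj₁ q with _ , p′ , refl ← ∈-map⁻ _ p | _ , q′ , refl ← ∈-map⁻ _ q = same-layer p′ q′ (x≢y ∘ cong (true ∷_))
  ... | inj₁ p | inj₂ q with _ , p′ , refl ← ∈-map⁻ _ p | _ , q′ , refl ← ∈-map⁻ _ q = cross-layer p′ q′
  ... | inj₂ p | inj₁ q with _ , p′ , refl ← ∈-map⁻ _ p | _ , q′ , refl ← ∈-map⁻ _ q = cross-layer p′ q′
  ... | inj₂ p | inj₂ q with _ , p′ , refl ← ∈-map⁻ _ p | _ , q′ , refl ← ∈-map⁻ _ q = same-layer p′ q′ (x≢y ∘ cong (false ∷_))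

-- Asymptotics

dim-zero : ∀ n → dim n 0 ≡ 1
dim-zero zero    = refl
dim-zero (suc n) = refl

dim-suc : ∀ n t → dim n (suc t) ≡ n C suc t + dim n t
dim-suc zero    t       = refl
dim-suc (suc n) zero    = begin
  dim n 1 + dim n 0            ≡⟨ cong₂ _+_ (dim-suc n 0) (dim-zero n) ⟩
  n C 1 + dim n 0 + 1          ≡⟨ cong (λ d → n C 1 + d + 1) (dim-zero n) ⟩
  n C 1 + 1 + 1                ≡⟨ cong (_+ 1) (trans (ℕ.+-comm (n C 1) 1) (nCk+nC[k+1]≡[n+1]C[k+1] n 0)) ⟩
  suc n C 1 + 1                ∎
dim-suc (suc n) (suc t) = begin
  dim n (suc (suc t)) + dim n (suc t)                   ≡⟨ cong₂ _+_ (dim-suc n (suc t)) (dim-suc n t) ⟩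
  c + dim n (suc t) + (b + dim n t)                     ≡⟨ regroup b c (dim n (suc t)) (dim n t) ⟩
  b + c + (dim n (suc t) + dim n t)                     ≡⟨ cong (_+ (dim n (suc t) + dim n t)) (nCk+nC[k+1]≡[n+1]C[k+1] n (suc t)) ⟩
  suc n C suc (suc t) + (dim n (suc t) + dim n t)       ∎
  where
  b = n C suc t
  c = n C suc (suc t)
  regroup : ∀ b c d e → c + d + (b + e) ≡ b + c + (d + e)
  regroup = ℕSolver.solve-∀

-- Here `(t + 1) * C(n,t+1) = (n - t) * C(n,t)`, and the hypothesis says `n - t ≥ q * (t + 1)`.
q*nCt≤nC[1+t] : ∀ t q n → t + q * suc t ≤ n → q * (n C t) ≤ n C suc t
q*nCt≤nC[1+t] t q n large = ℕ.*-cancelˡ-≤ (suc t) (ℕ.+-cancelʳ-≤ (t * (n C t)) _ _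
  (subst₂ _≤_ (regroup t q (n C t)) (sym (1+k*nC[1+k]+k*nCk≡n*nCk n t)) (ℕ.*-monoˡ-≤ (n C t) large)))
  where
  regroup : ∀ t q c → (t + q * suc t) * c ≡ suc t * (q * c) + t * c
  regroup = ℕSolver.solve-∀

-- The lower-order terms are negligible. The case `q = 1` one degree lower gives
-- `dim n (suc t) ≤ 2 * C(n,t+1)`; the ratio estimate with factor `q * 2` then finishes.
dim-dominated : ∀ t q → ∃[ N ] (∀ n → N ≤ n → q * dim n t ≤ n C suc t)
dim-dominated zero    q = q , λ n q≤n →
  subst₂ _≤_ (sym (trans (cong (q *_) (dim-zero n)) (ℕ.*-identityʳ q))) (sym (nC1≡n n)) q≤n
dim-dominated (suc t) q with N , dim≤ ← dim-dominated t 1 =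
  N ⊔ (suc t + q * 2 * suc (suc t)) , λ n N≤n →
    ℕ.≤-trans
      (subst (q * dim n (suc t) ≤_) (sym (ℕ.*-assoc q 2 (n C suc t)))
        (ℕ.*-monoʳ-≤ q (subst (_≤ 2 * (n C suc t)) (sym (dim-suc n t))
          (ℕ.+-monoʳ-≤ (n C suc t)
            (ℕ.≤-trans (subst (_≤ n C suc t) (ℕ.*-identityˡ (dim n t)) (dim≤ n (ℕ.m⊔n≤o⇒m≤o N _ N≤n)))
                       (ℕ.m≤m+n (n C suc t) 0))))))
      (q*nCt≤nC[1+t] (suc t) (q * 2) n (ℕ.m⊔n≤o⇒n≤o N _ N≤n))

-- Beyond the main term `2 * q * C(n,t)`, what remains is `2 * q` times a sum of lower binomials.
-- For large `n` it is at most one `C(n,t)`, which `p ≥ 1` pays for.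
upper-threshold : ∀ t p q → 0 < p → ∃[ N ] (∀ n → N ≤ n → q * (2 * dim n t) ≤ (2 * q + p) * (n C t))
upper-threshold zero    p q 0<p = 0 , λ n _ →
  subst₂ _≤_ (trans (unit q) (cong (λ d → q * (2 * d)) (sym (dim-zero n)))) (sym (ℕ.*-identityʳ (2 * q + p))) (ℕ.m≤m+n (2 * q) p)
  where
  unit : ∀ q → 2 * q ≡ q * (2 * 1)
  unit = ℕSolver.solve-∀
upper-threshold (suc t) p q 0<p with N , dim≤ ← dim-dominated t (2 * q) = N , λ n N≤n →
  subst₂ _≤_ (sym (trans (cong (λ d → q * (2 * d)) (dim-suc n t)) (distrib q (n C suc t) (dim n t))))
    (sym (ℕ.*-distribʳ-+ (n C suc t) (2 * q) p))
    (ℕ.+-monoʳ-≤ (2 * q * (n C suc t)) (ℕ.≤-trans (dim≤ n N≤n) (ℕ.m≤n*m (n C suc t) p {{>-nonZero 0<p}})))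
  where
  distrib : ∀ q c d → q * (2 * (c + d)) ≡ 2 * q * c + 2 * q * d
  distrib = ℕSolver.solve-∀

-- The layers live on one coordinate fewer than the code. Pascal splits `suc n C suc t` into
-- `A + B`, and with `r = 2 * q ∸ p < 2 * q` and `r * B ≤ A` one gets
-- `r * (A + B) ≤ (r + 1) * A ≤ 2 * q * A`.
lower-threshold : ∀ t p q → 0 < p → 0 < q →
  ∃[ N ] (∀ n → N ≤ n → (2 * q ∸ p) * (suc n C t) ≤ q * (2 * (n C t)))
lower-threshold zero    p q _ _ = 0 , λ n _ →
  subst₂ _≤_ (sym (ℕ.*-identityʳ (2 * q ∸ p))) (unit q) (ℕ.m∸n≤m (2 * q) p)
  where
  unit : ∀ q → 2 * q ≡ q * (2 * 1)
  unit = ℕSolver.solve-∀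
lower-threshold (suc t) p q 0<p 0<q = t + 2 * q * suc t , λ n large →
  let A = n C suc t
      B = n C t
      r = 2 * q ∸ p
      rB≤A : r * B ≤ A
      rB≤A = ℕ.≤-trans (ℕ.*-monoˡ-≤ B (ℕ.m∸n≤m (2 * q) p)) (q*nCt≤nC[1+t] t (2 * q) n large)
      r<2q : r < 2 * q
      r<2q = ℕ.m<n+o⇒m∸n<o (2 * q) p {{ℕ.m*n≢0 2 q {{_}} {{>-nonZero 0<q}}}} (ℕ.m<n+m (2 * q) 0<p)
  in subst₂ _≤_ (trans (sym (ℕ.*-distribˡ-+ r B A)) (cong (r *_) (nCk+nC[k+1]≡[n+1]C[k+1] n t))) (regroup q A)
       (ℕ.≤-trans (ℕ.+-monoˡ-≤ (r * A) rB≤A) (ℕ.*-monoˡ-≤ A r<2q))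
  where
  regroup : ∀ q c → 2 * q * c ≡ q * (2 * c)
  regroup = ℕSolver.solve-∀

-- The `o(1)` is unfolded with a rational error `p / q` and cleared denominators; the maximum is
-- captured by a witness from below and a bound on all codes from above.
theorem8 : (k : ℕ) → 1 ≤ k →
    (p q : ℕ) → 0 < p → 0 < q →
    ∃[ N ] ((n : ℕ) → N ≤ n →
    (∃[ c ] ((2 * q ∸ p) * binom k n ≤ q * length (words {Lset k n} {n} c)))
    × ((c : Code (Lset k n) n) →
    q * length (words c) ≤ (2 * q + p) * binom k n))
theorem8 (suc a) _ p q 0<p 0<q with L , lower ← lower-threshold (2 ^ a ∸ 1) p q 0<p 0<q
                                  | U , upper ← upper-threshold (2 ^ a ∸ 1) p q 0<p = suc L ⊔ U , bounds
  where
  t+1≡2^a : suc (2 ^ a ∸ 1) ≡ 2 ^ a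
  t+1≡2^a = ℕ.suc-pred (2 ^ a) {{ℕ.m^n≢0 2 a}}
  bounds : ∀ n → suc L ⊔ U ≤ n → _
  bounds n N≤n = below n (ℕ.m⊔n≤o⇒m≤o (suc L) U N≤n) , λ c →
    ℕ.≤-trans (ℕ.*-monoʳ-≤ q (code-size≤2*dim a t+1≡2^a c)) (upper n (ℕ.m⊔n≤o⇒n≤o (suc L) U N≤n))
    where
    below : ∀ n → suc L ≤ n → ∃[ c ] ((2 * q ∸ p) * binom (suc a) n ≤ q * length (words {Lset (suc a) n} {n} c))
    -- One coordinate is spent on the layer bit, so the threshold `L` for the layer length `m`
    -- becomes `suc L` for `n`.
    below (suc m) (s≤s L≤m) with c , size ← two-layer-code a t+1≡2^a m =
      c , subst (λ l → (2 * q ∸ p) * binom (suc a) (suc m) ≤ q * l) (sym size) (lower m L≤m)
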